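{- For all $n\geq 2$ and $k\geq 2$, the restricted edge-connectivity of the DCell satisfies $\lambda_2(D_{k,n})=2n+2k-4$.
   Context: DCell $D_{k,n}$ ($n\geq 2$, $k\geq 0$) is defined recursively. $D_{0,n}$ is the complete graph $K_n$ on vertices $0,1,\dots,n-1$. Let $t_{k,n}=|V(D_{k,n})|$. For $k\geq1$, $D_{k,n}$ is built from $t_{k-1,n}+1$ disjoint copies $D^0_{k-1,n},\dots,D^{t_{k-1,n}}_{k-1,n}$ of $D_{k-1,n}$; a vertex of copy $D^i_{k-1,n}$ is labeled $(i,a_{k-1},\dots,a_0)$, where $(a_{k-1},\dots,a_0)$ is its label in $D_{k-1,n}$, and its index within the copy is $uid_{k-1}=a_0+\sum_{l=1}^{k-1}a_l t_{l-1,n}$. For each pair $a<b$ of copy indices, one new edge (a level $k$ edge) joins the vertex of $D^a_{k-1,n}$ with $uid_{k-1}=b-1$ to the vertex of $D^b_{k-1,n}$ with $uid_{k-1}=a$. For a graph $G$ and $m\geq2$, an edge set $F$ is an $m$-restricted edge-cut if $G-F$ is disconnected and every component of $G-F$ has at least $m$ vertices; $\lambda_m(G)$ is the minimum size of an $m$-restricted edge-cut ($\lambda_2$ is the restricted edge-connectivity). -}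

module Defs where

open import Data.Nat using (ℕ; zero; suc; _+_; _*_; _∸_; _<_; _≥_; _≡ᵇ_; _<ᵇ_)
open import Data.Nat.DivMod using (_/_; _%_)
open import Data.Bool using (Bool; true; false; _∧_; _∨_; not; T)
open import Data.Fin using (Fin; toℕ)
open import Data.List using (List; map; allFin; length)
open import Data.Nat.ListAction using (sum)
open import Data.Product using (Σ; _×_; ∃; _,_)
open import Relation.Binary.PropositionalEquality using (_≡_; _≢_)
open import Relation.Nullary using (¬_)
open import Function.Definitions using (Injective)

record Graph : Set where
  field
    N   : ℕ
    adj : Fin N → Fin N → Bool

open Graph public

t : ℕ → ℕ → ℕ
t zero    n = n
t (suc k) n = t k n * (t k n + 1)

-- quotient / remainder by t, guarded against t = 0 (irrelevant for n ≥ 2)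
divT : ℕ → ℕ → ℕ
divT u zero    = 0
divT u (suc s) = u / suc s

modT : ℕ → ℕ → ℕ
modT u zero    = u
modT u (suc s) = u % suc s

-- Vertices of D_{k,n} are identified with their uid_k ∈ {0,…,t k n - 1}.
-- The vertex (i, a_{k-1},…,a_0) of D_{k,n} (in copy i of D_{k-1,n}) has
-- uid_k = i * t_{k-1,n} + uid_{k-1}(a_{k-1},…,a_0).
-- dadj k n u v : are vertices with uid u and v adjacent in D_{k,n}?
dadj : ℕ → ℕ → ℕ → ℕ → Bool
dadj zero    n u v = not (u ≡ᵇ v)
dadj (suc k) n u v =
  let s = t k n
      i = divT u s
      a = modT u s
      j = divT v s
      b = modT v s
  in ((i ≡ᵇ j) ∧ dadj k n a b)
     ∨ ((i <ᵇ j) ∧ (a ≡ᵇ (j ∸ 1)) ∧ (b ≡ᵇ i))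
     ∨ ((j <ᵇ i) ∧ (b ≡ᵇ (i ∸ 1)) ∧ (a ≡ᵇ j))

DCell : ℕ → ℕ → Graph
DCell k n = record { N = t k n ; adj = λ u v → dadj k n (toℕ u) (toℕ v) }

-- Edge sets.  An edge set of G is given by a Bool-valued selector F on
-- ordered pairs; the edge {u,v} of G belongs to the set iff
-- F u v ∨ F v u (non-edges selected by F are ignored).

EdgeSet : Graph → Set
EdgeSet G = Fin (N G) → Fin (N G) → Bool

inF : (G : Graph) → EdgeSet G → Fin (N G) → Fin (N G) → Bool
inF G F u v = adj G u v ∧ (F u v ∨ F v u)

size : (G : Graph) → EdgeSet G → ℕ
size G F = sum (map (λ u → sum (map (λ v →
  if′ ((toℕ u <ᵇ toℕ v) ∧ inF G F u v)) (allFin (N G)))) (allFin (N G)))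
  where
  if′ : Bool → ℕ
  if′ true  = 1
  if′ false = 0

adjMinus : (G : Graph) → EdgeSet G → Fin (N G) → Fin (N G) → Bool
adjMinus G F u v = adj G u v ∧ not (F u v ∨ F v u)

data Reach (G : Graph) (F : EdgeSet G) (u : Fin (N G)) : Fin (N G) → Set where
  here : Reach G F u u
  step : ∀ {v w} → Reach G F u v → T (adjMinus G F v w) → Reach G F u w

Disconnected : (G : Graph) → EdgeSet G → Set
Disconnected G F = Σ (Fin (N G)) λ u → Σ (Fin (N G)) λ v → ¬ Reach G F u v

ComponentsAtLeast : ℕ → (G : Graph) → EdgeSet G → Set
ComponentsAtLeast m G F =
  (u : Fin (N G)) → Σ (Fin m → Fin (N G)) λ f →
    Injective _≡_ _≡_ f × ((i : Fin m) → Reach G F u (f i))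

IsRestrictedCut : ℕ → (G : Graph) → EdgeSet G → Set
IsRestrictedCut m G F = Disconnected G F × ComponentsAtLeast m G F

RestrictedConn : ℕ → Graph → ℕ → Set
RestrictedConn m G c =
  (Σ (EdgeSet G) λ F → IsRestrictedCut m G F × size G F ≡ c)
  × ((F : EdgeSet G) → IsRestrictedCut m G F → size G F ≥ c)

{-# OPTIONS --safe #-}
-- Since D_k arises from t + 1 copies of D_{k-1} (with t vertices each) by
-- joining every two copies by one edge, every vertex lies on one level k edge.
-- For a vertex set X consider the copies that X meets without filling.  Two of
-- them already contribute twice the edge-connectivity n + k - 2 of D_{k-1},
-- which is exactly 2n + 2k - 4.  If there are both full and empty copies, the
-- cut has at least t edges, which is more than enough.  Otherwise X or its complement is
-- contained in one copy, and then its cut is the cut inside the copy plus its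
-- cardinality, to which induction applies.  The bound is attained by the edges
-- leaving an edge of D_0.
module Submission where

open import Defs
open import Data.Nat using (ℕ; _+_; _*_; _∸_; _≥_; zero; suc; pred; _≤_; _<_; _≟_; _≤?_; _<?_;
  _≡ᵇ_; _<ᵇ_; z≤n; s≤s; z<s; s<s; s≤s⁻¹; >-nonZero)
open import Data.Nat.DivMod using (_/_; _%_; +-distrib-/-∣ˡ; m*n/n≡m; m<n⇒m/n≡0; [m+kn]%n≡m%n; m<n⇒m%n≡m)
open import Data.Nat.Divisibility using (divides-refl)
import Data.Nat.ListAction as List
open import Data.Nat.Properties
open import Data.Nat.Tactic.RingSolver using (solve-∀)
open import Algebra.Properties.Semiring.Sum +-*-semiring
  using (sum; sum-cong-≗; sum-replicate-zero; ∑-distrib-+; ∑-comm; *-distribˡ-sum; *-distribʳ-sum)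
open import Data.Bool using (Bool; true; false; _∧_; _∨_; not; T; if_then_else_)
open import Data.Bool.Properties
  using (∨-comm; ∧-comm; ∨-identityʳ; ∧-identityʳ; not-involutive; T?; T-∧; T-∨; T-not-≡)
open import Data.Fin using (Fin; toℕ; fromℕ<)
open import Data.Fin.Properties using (toℕ<n; toℕ-injective; toℕ-fromℕ<; fromℕ<-toℕ; sequence)
open import Data.List using (map; tabulate; allFin)
open import Data.List.Properties using (map-tabulate)
open import Data.Product using (Σ; _×_; ∃-syntax; _,_; proj₁; proj₂)
open import Data.Sum using (_⊎_; inj₁; inj₂)
open import Effect.Monad using (RawMonad)
open import Function using (_∘_; id)
open import Function.Bundles using (Equivalence)
open import Function.Definitions using (Injective)
open import Relation.Binary.Definitions using (tri<; tri≈; tri>)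
open import Relation.Binary.PropositionalEquality
open import Relation.Nullary using (¬_; Dec; yes; no; does; contradiction)
open import Relation.Nullary.Decidable
  using (¬?; _×-dec_; decidable-stable; ¬¬-excluded-middle; dec-true; dec-false)
open import Relation.Nullary.Negation using (¬¬-Monad; ¬¬-map)

-- Sums over initial segments of the naturals.

∑ : ℕ → (ℕ → ℕ) → ℕ
∑ n f = sum {n} (f ∘ toℕ)

∑-cong : ∀ {f g : ℕ → ℕ} n → (∀ i → i < n → f i ≡ g i) → ∑ n f ≡ ∑ n g
∑-cong n f≡g = sum-cong-≗ {n} λ i → f≡g (toℕ i) (toℕ<n i)

∑-cong₂ : ∀ m n {h k : ℕ → ℕ → ℕ} → (∀ i → i < m → ∀ j → j < n → h i j ≡ k i j) →
          ∑ m (λ i → ∑ n (h i)) ≡ ∑ m (λ i → ∑ n (k i))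
∑-cong₂ m n h≡k = ∑-cong m λ i i<m → ∑-cong n (h≡k i i<m)

∑-zero : ∀ n {f : ℕ → ℕ} → (∀ i → i < n → f i ≡ 0) → ∑ n f ≡ 0
∑-zero n f≡0 = trans (∑-cong n f≡0) (sum-replicate-zero n)

∑-+ : ∀ n f g → ∑ n (λ i → f i + g i) ≡ ∑ n f + ∑ n g
∑-+ n f g = ∑-distrib-+ {n} (f ∘ toℕ) (g ∘ toℕ)

∑-swap : ∀ m n (h : ℕ → ℕ → ℕ) → ∑ m (λ i → ∑ n (h i)) ≡ ∑ n (λ j → ∑ m (λ i → h i j))
∑-swap m n h = ∑-comm {m} {n} (λ i j → h (toℕ i) (toℕ j))

∑-*ˡ : ∀ n x f → ∑ n (λ i → x * f i) ≡ x * ∑ n f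
∑-*ˡ n x f = sym (*-distribˡ-sum {n} x (f ∘ toℕ))

∑-*ʳ : ∀ n f x → ∑ n (λ i → f i * x) ≡ ∑ n f * x
∑-*ʳ n f x = sym (*-distribʳ-sum {n} x (f ∘ toℕ))

sum-mono : ∀ {n} {f g : Fin n → ℕ} → (∀ i → f i ≤ g i) → sum f ≤ sum g
sum-mono {zero}  f≤g = z≤n
sum-mono {suc n} f≤g = +-mono-≤ (f≤g Fin.zero) (sum-mono (f≤g ∘ Fin.suc))

∑-mono : ∀ {f g : ℕ → ℕ} n → (∀ i → i < n → f i ≤ g i) → ∑ n f ≤ ∑ n g
∑-mono n f≤g = sum-mono λ i → f≤g (toℕ i) (toℕ<n i)

∑-mono₂ : ∀ m n {h k : ℕ → ℕ → ℕ} → (∀ i → i < m → ∀ j → j < n → h i j ≤ k i j) →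
          ∑ m (λ i → ∑ n (h i)) ≤ ∑ m (λ i → ∑ n (k i))
∑-mono₂ m n h≤k = ∑-mono m λ i i<m → ∑-mono n (h≤k i i<m)

∑-only : ∀ {f : ℕ → ℕ} n {c} → c < n → (∀ i → i < n → i ≢ c → f i ≡ 0) → ∑ n f ≡ f c
∑-only {f} (suc n) {zero} _ f≡0 =
  trans (cong (f 0 +_) (∑-zero n λ i i<n → f≡0 (suc i) (s<s i<n) λ ())) (+-identityʳ _)
∑-only (suc n) {suc c} (s<s c<n) f≡0 = cong₂ _+_ (f≡0 0 z<s λ ())
  (∑-only n c<n λ i i<n i≢c → f≡0 (suc i) (s<s i<n) (i≢c ∘ suc-injective))

term≤∑ : ∀ n f {c} → c < n → f c ≤ ∑ n f
term≤∑ (suc n) f {zero}  _         = m≤m+n _ _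
term≤∑ (suc n) f {suc c} (s<s c<n) = m≤n⇒m≤o+n (f 0) (term≤∑ n (f ∘ suc) c<n)

two-terms≤∑ : ∀ n f {c d} → c < n → d < n → c ≢ d → f c + f d ≤ ∑ n f
two-terms≤∑ (suc n) f {zero}  {zero}  _ _ c≢d = contradiction refl c≢d
two-terms≤∑ (suc n) f {zero}  {suc d} _ (s<s d<n) _ = +-monoʳ-≤ (f 0) (term≤∑ n (f ∘ suc) d<n)
two-terms≤∑ (suc n) f {suc c} {zero}  (s<s c<n) _ _ =
  ≤-trans (≤-reflexive (+-comm _ (f 0))) (+-monoʳ-≤ (f 0) (term≤∑ n (f ∘ suc) c<n))
two-terms≤∑ (suc n) f {suc c} {suc d} (s<s c<n) (s<s d<n) c≢d =
  m≤n⇒m≤o+n (f 0) (two-terms≤∑ n (f ∘ suc) c<n d<n (c≢d ∘ cong suc))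

∑≡0⇒term≡0 : ∀ n f → ∑ n f ≡ 0 → ∀ i → i < n → f i ≡ 0
∑≡0⇒term≡0 n f ∑≡0 i i<n = n≤0⇒n≡0 (subst (f i ≤_) ∑≡0 (term≤∑ n f i<n))

∑-positive : ∀ n f → 1 ≤ ∑ n f → ∃[ i ] (i < n × 1 ≤ f i)
∑-positive (suc n) f p with f 0 in eq
... | suc _ = 0 , z<s , subst (1 ≤_) (sym eq) z<s
... | zero  with i , i<n , q ← ∑-positive n (f ∘ suc) p = suc i , s<s i<n , q

∑-const : ∀ n x → ∑ n (λ _ → x) ≡ n * x
∑-const zero    x = refl
∑-const (suc n) x = cong (x +_) (∑-const n x)

∑-append : ∀ m n f → ∑ (m + n) f ≡ ∑ m f + ∑ n (λ i → f (m + i))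
∑-append zero    n f = refl
∑-append (suc m) n f = trans (cong (f 0 +_) (∑-append m n (f ∘ suc))) (sym (+-assoc (f 0) _ _))

∑-blocks : ∀ m s f → ∑ (m * s) f ≡ ∑ m (λ i → ∑ s (λ a → f (i * s + a)))
∑-blocks zero    s f = refl
∑-blocks (suc m) s f = trans (∑-append s (m * s) f) (cong (∑ s f +_) (trans
  (∑-blocks m s (λ i → f (s + i)))
  (∑-cong₂ m s λ i _ a _ → cong f (sym (+-assoc s (i * s) a)))))

-- Indicators and cardinalities of vertex sets.

⟦_⟧ : Bool → ℕ
⟦ true  ⟧ = 1
⟦ false ⟧ = 0

⟦∧⟧ : ∀ a b → ⟦ a ∧ b ⟧ ≡ ⟦ a ⟧ * ⟦ b ⟧
⟦∧⟧ true  b = sym (+-identityʳ _)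
⟦∧⟧ false b = refl

≡ᵇ-refl : ∀ i → (i ≡ᵇ i) ≡ true
≡ᵇ-refl zero    = refl
≡ᵇ-refl (suc i) = ≡ᵇ-refl i

≢⇒≡ᵇ : ∀ {i j} → i ≢ j → (i ≡ᵇ j) ≡ false
≢⇒≡ᵇ {zero}  {zero}  i≢j = contradiction refl i≢j
≢⇒≡ᵇ {zero}  {suc j} _   = refl
≢⇒≡ᵇ {suc i} {zero}  _   = refl
≢⇒≡ᵇ {suc i} {suc j} i≢j = ≢⇒≡ᵇ {i} {j} (i≢j ∘ cong suc)

≡ᵇ-sym : ∀ i j → (i ≡ᵇ j) ≡ (j ≡ᵇ i)
≡ᵇ-sym zero    zero    = refl
≡ᵇ-sym zero    (suc j) = refl
≡ᵇ-sym (suc i) zero    = refl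
≡ᵇ-sym (suc i) (suc j) = ≡ᵇ-sym i j

<⇒<ᵇ-true : ∀ {i j} → i < j → (i <ᵇ j) ≡ true
<⇒<ᵇ-true {zero}  {suc j} _         = refl
<⇒<ᵇ-true {suc i} {suc j} (s<s i<j) = <⇒<ᵇ-true i<j

≤⇒<ᵇ-false : ∀ {i j} → j ≤ i → (i <ᵇ j) ≡ false
≤⇒<ᵇ-false {i}     {zero}  _         = refl
≤⇒<ᵇ-false {suc i} {suc j} (s≤s j≤i) = ≤⇒<ᵇ-false j≤i

co : (ℕ → Bool) → ℕ → Bool
co X = not ∘ X

card : ℕ → (ℕ → Bool) → ℕ
card n X = ∑ n (⟦_⟧ ∘ X)

card-co : ∀ n X → card n X + card n (co X) ≡ n
card-co n X = begin
  card n X + card n (co X)              ≡⟨ ∑-+ n (⟦_⟧ ∘ X) (⟦_⟧ ∘ co X) ⟨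
  ∑ n (λ i → ⟦ X i ⟧ + ⟦ not (X i) ⟧)  ≡⟨ ∑-cong n (λ i _ → lem (X i)) ⟩
  ∑ n (λ _ → 1)                        ≡⟨ ∑-const n 1 ⟩
  n * 1                                ≡⟨ *-identityʳ n ⟩
  n                                    ∎
  where
  open ≡-Reasoning
  lem : ∀ b → ⟦ b ⟧ + ⟦ not b ⟧ ≡ 1
  lem true  = refl
  lem false = refl

card≡0⇒false : ∀ n X → card n X ≡ 0 → ∀ i → i < n → X i ≡ false
card≡0⇒false n X p i i<n with X i | ∑≡0⇒term≡0 n (⟦_⟧ ∘ X) p i i<n
... | false | _ = refl

card-co≡0⇒true : ∀ n X → card n (co X) ≡ 0 → ∀ i → i < n → X i ≡ true
card-co≡0⇒true n X p i i<n =
  trans (sym (not-involutive (X i))) (cong not (card≡0⇒false n (co X) p i i<n))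

-- Level edges, coordinates of vertices, and cuts.

-- The vertex of copy c that carries the edge from copy c to copy j.
port : ℕ → ℕ → ℕ
port zero    j       = pred j
port (suc c) zero    = zero
port (suc c) (suc j) = suc (port c j)

port-< : ∀ {i j} → i < j → port i j ≡ j ∸ 1
port-< {zero}  {suc j}       _               = refl
port-< {suc i} {suc (suc j)} (s<s i<j)       = cong suc (port-< i<j)

port-> : ∀ {i j} → j < i → port i j ≡ j
port-> {suc i} {zero}  _         = refl
port-> {suc i} {suc j} (s<s j<i) = cong suc (port-> j<i)

port-bound : ∀ {s i j} → i ≤ s → j ≤ s → i ≢ j → port i j < s
port-bound {s} {i} {j} i≤s j≤s i≢j with <-cmp i j
... | tri< i<j _ _ = subst (_< s) (sym (port-< i<j)) (≤-trans (lem i<j) j≤s)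
  where
  lem : ∀ {i j} → i < j → suc (j ∸ 1) ≤ j
  lem (s<s _) = ≤-refl
... | tri≈ _ i≡j _ = contradiction i≡j i≢j
... | tri> _ _ j<i = subst (_< s) (sym (port-> j<i)) (<-≤-trans j<i i≤s)

-- For fixed `c`, the map `port c` is a bijection from the copy indices other than `c` onto the
-- vertices of copy `c`: each vertex carries exactly one edge to another copy.
∑-port : ∀ s c g → c ≤ s → ∑ (suc s) (λ j → if c ≡ᵇ j then 0 else g (port c j)) ≡ ∑ s g
∑-port s       zero    g _         = refl
∑-port (suc s) (suc c) g (s≤s c≤s) = cong (g 0 +_) (∑-port s c (g ∘ suc) c≤s)

divT-+ : ∀ i {a s} → a < s → divT (i * s + a) s ≡ i
divT-+ i {a} {s@(suc _)} a<s = begin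
  (i * s + a) / s      ≡⟨ +-distrib-/-∣ˡ a (divides-refl i) ⟩
  i * s / s + a / s    ≡⟨ cong₂ _+_ (m*n/n≡m i s) (m<n⇒m/n≡0 a<s) ⟩
  i + 0                ≡⟨ +-identityʳ i ⟩
  i                    ∎
  where open ≡-Reasoning

modT-+ : ∀ i {a s} → a < s → modT (i * s + a) s ≡ a
modT-+ i {a} {s@(suc _)} a<s = begin
  (i * s + a) % s  ≡⟨ cong (_% s) (+-comm (i * s) a) ⟩
  (a + i * s) % s  ≡⟨ [m+kn]%n≡m%n a i s ⟩
  a % s            ≡⟨ m<n⇒m%n≡m a<s ⟩
  a                ∎
  where open ≡-Reasoning

dadj-sym : ∀ k n u v → dadj k n u v ≡ dadj k n v u
dadj-sym zero    n u v = cong not (≡ᵇ-sym u v)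
dadj-sym (suc k) n u v = cong₂ _∨_
  (cong₂ _∧_ (≡ᵇ-sym (divT u s) (divT v s)) (dadj-sym k n (modT u s) (modT v s)))
  (∨-comm ((divT u s <ᵇ divT v s) ∧ _) _)
  where s = t k n

-- The sum runs over ordered pairs, but only the orientation leaving `X` contributes, so each
-- boundary edge is counted once.
cut : ℕ → ℕ → (ℕ → Bool) → ℕ
cut k n X = ∑ (t k n) λ u → ∑ (t k n) λ v → ⟦ X u ∧ not (X v) ∧ dadj k n u v ⟧

cut-co : ∀ k n X → cut k n (co X) ≡ cut k n X
cut-co k n X = trans (∑-swap (t k n) (t k n) λ u v → ⟦ co X u ∧ not (co X v) ∧ dadj k n u v ⟧) (∑-cong₂ (t k n) (t k n) λ u _ v _ →
  trans (cong (λ e → ⟦ not (X v) ∧ not (not (X u)) ∧ e ⟧) (dadj-sym k n v u)) (lem (X u) (X v) _))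
  where
  lem : ∀ x y e → ⟦ not y ∧ not (not x) ∧ e ⟧ ≡ ⟦ x ∧ not y ∧ e ⟧
  lem true  y e = refl
  lem false true  e = refl
  lem false false e = refl

cut-false : ∀ k n X → (∀ u → u < t k n → X u ≡ false) → cut k n X ≡ 0
cut-false k n X p = ∑-zero (t k n) λ u u<t → ∑-zero (t k n) λ v _ →
  cong (λ x → ⟦ x ∧ not (X v) ∧ dadj k n u v ⟧) (p u u<t)

cut₀ : ∀ n X → cut 0 n X ≡ card n X * card n (co X)
cut₀ n X = begin
  ∑ n (λ u → ∑ n λ v → ⟦ X u ∧ not (X v) ∧ not (u ≡ᵇ v) ⟧)
    ≡⟨ ∑-cong₂ n n (λ u _ v _ → trans (lem u v) (⟦∧⟧ (X u) (not (X v)))) ⟩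
  ∑ n (λ u → ∑ n λ v → ⟦ X u ⟧ * ⟦ not (X v) ⟧)
    ≡⟨ ∑-cong n (λ u _ → ∑-*ˡ n ⟦ X u ⟧ (⟦_⟧ ∘ co X)) ⟩
  ∑ n (λ u → ⟦ X u ⟧ * card n (co X))
    ≡⟨ ∑-*ʳ n (⟦_⟧ ∘ X) (card n (co X)) ⟩
  card n X * card n (co X) ∎
  where
  open ≡-Reasoning
  lem : ∀ u v → ⟦ X u ∧ not (X v) ∧ not (u ≡ᵇ v) ⟧ ≡ ⟦ X u ∧ not (X v) ⟧
  lem u v with u ≟ v
  ... | no u≢v rewrite ≢⇒≡ᵇ u≢v = cong (λ e → ⟦ X u ∧ e ⟧) (∧-identityʳ _)
  ... | yes refl with X u
  ...   | true  = refl
  ...   | false = refl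

-- The cut of a DCell in terms of its copies.

module Blocks (k n : ℕ) where

  s : ℕ
  s = t k n

  dadj-block : ∀ i {a} j {b} → a < s → b < s →
    dadj (suc k) n (i * s + a) (j * s + b) ≡
      ((i ≡ᵇ j) ∧ dadj k n a b)
      ∨ ((i <ᵇ j) ∧ (a ≡ᵇ (j ∸ 1)) ∧ (b ≡ᵇ i))
      ∨ ((j <ᵇ i) ∧ (b ≡ᵇ (i ∸ 1)) ∧ (a ≡ᵇ j))
  dadj-block i j a<s b<s
    rewrite divT-+ i a<s | modT-+ i a<s | divT-+ j b<s | modT-+ j b<s = refl

  dadj-same : ∀ i {a b} → a < s → b < s → dadj (suc k) n (i * s + a) (i * s + b) ≡ dadj k n a b
  dadj-same i {a} {b} a<s b<s
    rewrite dadj-block i i a<s b<s | ≡ᵇ-refl i | ≤⇒<ᵇ-false (≤-refl {i}) = ∨-identityʳ _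

  -- The two cases `i < j` and `j < i` of the construction merge into one formula, symmetric in the
  -- two copies, once the ends are expressed by `port`.
  dadj-cross : ∀ {i j a b} → i ≢ j → a < s → b < s →
    dadj (suc k) n (i * s + a) (j * s + b) ≡ (a ≡ᵇ port i j) ∧ (b ≡ᵇ port j i)
  dadj-cross {i} {j} {a} {b} i≢j a<s b<s with <-cmp i j
  ... | tri< i<j _ _
    rewrite dadj-block i j a<s b<s | ≢⇒≡ᵇ i≢j | <⇒<ᵇ-true i<j | ≤⇒<ᵇ-false (<⇒≤ i<j)
          | port-< i<j | port-> i<j = ∨-identityʳ _
  ... | tri≈ _ i≡j _ = contradiction i≡j i≢j
  ... | tri> _ _ j<i
    rewrite dadj-block i j a<s b<s | ≢⇒≡ᵇ i≢j | <⇒<ᵇ-true j<i | ≤⇒<ᵇ-false (<⇒≤ j<i)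
          | port-< j<i | port-> j<i = ∧-comm (b ≡ᵇ (i ∸ 1)) _

  block : (ℕ → Bool) → ℕ → ℕ → Bool
  block X i a = X (i * s + a)

  ∑-vertices : ∀ f → ∑ (t (suc k) n) f ≡ ∑ (suc s) λ i → ∑ s λ a → f (i * s + a)
  ∑-vertices f = trans
    (cong (λ N → ∑ N f) (trans (*-comm s (s + 1)) (cong (_* s) (+-comm s 1))))
    (∑-blocks (suc s) s f)

  card-blocks : ∀ X → card (t (suc k) n) X ≡ ∑ (suc s) λ i → card s (block X i)
  card-blocks X = ∑-vertices (⟦_⟧ ∘ X)

  -- Entry `(i, j)` counts the boundary edges from copy `i` to copy `j`. Off the diagonal there is a
  -- single candidate edge.
  between : (ℕ → Bool) → ℕ → ℕ → ℕ
  between X i j = if i ≡ᵇ j then cut k n (block X i)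
                  else ⟦ block X i (port i j) ∧ not (block X j (port j i)) ⟧

  between-same : ∀ X i → between X i i ≡ cut k n (block X i)
  between-same X i rewrite ≡ᵇ-refl i = refl

  between-cross : ∀ X {i j} → i ≢ j →
    between X i j ≡ ⟦ block X i (port i j) ∧ not (block X j (port j i)) ⟧
  between-cross X i≢j rewrite ≢⇒≡ᵇ i≢j = refl

  cut-between : ∀ X {i j} → i ≤ s → j ≤ s →
    (∑ s λ a → ∑ s λ b →
      ⟦ block X i a ∧ not (block X j b) ∧ dadj (suc k) n (i * s + a) (j * s + b) ⟧)
    ≡ between X i j
  cut-between X {i} {j} i≤s j≤s with i ≟ j
  ... | yes refl = trans
    (∑-cong₂ s s λ a a<s b b<s →
      cong (λ e → ⟦ block X i a ∧ not (block X i b) ∧ e ⟧) (dadj-same i a<s b<s))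
    (sym (between-same X i))
  ... | no i≢j = begin
    (∑ s λ a → ∑ s λ b → ⟦ block X i a ∧ not (block X j b) ∧ dadj (suc k) n (i * s + a) (j * s + b) ⟧)
      ≡⟨ ∑-cong₂ s s (λ a a<s b b<s → cong (λ e → ⟦ block X i a ∧ not (block X j b) ∧ e ⟧)
           (dadj-cross i≢j a<s b<s)) ⟩
    ∑ s (λ a → ∑ s (h a))
      -- The sum over `a`, and then the one over `b`, collapses to an end of the only edge joining
      -- the two copies.
      ≡⟨ ∑-only s (port-bound i≤s j≤s i≢j)
           (λ a _ a≢p → ∑-zero s {h a} λ b _ → off₁ (block X i a) (not (block X j b)) a≢p) ⟩
    ∑ s (h p)
      ≡⟨ ∑-only s (port-bound j≤s i≤s (i≢j ∘ sym))
           (λ b _ b≢q → off₂ (block X i p) (not (block X j b)) (p ≡ᵇ p) b≢q) ⟩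
    h p q
      ≡⟨ on ⟩
    ⟦ block X i p ∧ not (block X j q) ⟧
      ≡⟨ between-cross X i≢j ⟨
    between X i j ∎
    where
    open ≡-Reasoning
    p = port i j
    q = port j i
    h : ℕ → ℕ → ℕ
    h a b = ⟦ block X i a ∧ not (block X j b) ∧ (a ≡ᵇ p) ∧ (b ≡ᵇ q) ⟧
    off₁ : ∀ x y {a e} → a ≢ p → ⟦ x ∧ y ∧ (a ≡ᵇ p) ∧ e ⟧ ≡ 0
    off₁ false y     a≢p = refl
    off₁ true  false a≢p = refl
    off₁ true  true  a≢p rewrite ≢⇒≡ᵇ a≢p = refl
    off₂ : ∀ x y e {b} → b ≢ q → ⟦ x ∧ y ∧ e ∧ (b ≡ᵇ q) ⟧ ≡ 0
    off₂ false y     e     b≢q = refl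
    off₂ true  false e     b≢q = refl
    off₂ true  true  false b≢q = refl
    off₂ true  true  true  b≢q rewrite ≢⇒≡ᵇ b≢q = refl
    on : h p q ≡ ⟦ block X i p ∧ not (block X j q) ⟧
    on rewrite ≡ᵇ-refl p | ≡ᵇ-refl q = cong (λ e → ⟦ block X i p ∧ e ⟧) (∧-identityʳ _)

  cut-blocks : ∀ X → cut (suc k) n X ≡ ∑ (suc s) λ i → ∑ (suc s) (between X i)
  cut-blocks X = begin
    cut (suc k) n X
      ≡⟨ ∑-vertices (λ u → ∑ (t (suc k) n) (E u)) ⟩
    (∑ (suc s) λ i → ∑ s λ a → ∑ (t (suc k) n) (E (i * s + a)))
      ≡⟨ ∑-cong₂ (suc s) s (λ i _ a _ → ∑-vertices (E (i * s + a))) ⟩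
    (∑ (suc s) λ i → ∑ s λ a → ∑ (suc s) λ j → ∑ s λ b → E (i * s + a) (j * s + b))
      ≡⟨ ∑-cong (suc s) (λ i _ → ∑-swap s (suc s) λ a j → ∑ s λ b → E (i * s + a) (j * s + b)) ⟩
    (∑ (suc s) λ i → ∑ (suc s) λ j → ∑ s λ a → ∑ s λ b → E (i * s + a) (j * s + b))
      ≡⟨ ∑-cong₂ (suc s) (suc s) (λ i i≤s j j≤s → cut-between X (s≤s⁻¹ i≤s) (s≤s⁻¹ j≤s)) ⟩
    (∑ (suc s) λ i → ∑ (suc s) (between X i)) ∎
    where
    open ≡-Reasoning
    E : ℕ → ℕ → ℕ
    E u v = ⟦ X u ∧ not (X v) ∧ dadj (suc k) n u v ⟧

  module Concentrated (X : ℕ → Bool) {c} (c≤s : c ≤ s)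
    (elsewhere : ∀ i → i ≤ s → i ≢ c → ∀ a → a < s → block X i a ≡ false) where

    card-concentrated : card (t (suc k) n) X ≡ card s (block X c)
    card-concentrated = trans (card-blocks X) (∑-only (suc s) (s≤s c≤s) λ i i<n i≢c →
      ∑-zero s λ a a<s → cong ⟦_⟧ (elsewhere i (s≤s⁻¹ i<n) i≢c a a<s))

    -- Every level edge at copy `c` ends in a copy free of `X`, so each vertex of `X` adds exactly
    -- one edge to the cut inside the copy.
    cut-concentrated : cut (suc k) n X ≡ cut k n (block X c) + card s (block X c)
    cut-concentrated = begin
      cut (suc k) n X
        ≡⟨ cut-blocks X ⟩
      (∑ (suc s) λ i → ∑ (suc s) (between X i))
        ≡⟨ ∑-only (suc s) (s≤s c≤s) (λ i i<n i≢c → ∑-zero (suc s) λ j j<n →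
             vanish i j (s≤s⁻¹ i<n) (s≤s⁻¹ j<n) i≢c) ⟩
      ∑ (suc s) (between X c)
        -- Only row `c` is left. It splits into its diagonal entry `d` and the edges `e` to other
        -- copies, which `∑-port` reindexes by the vertices of the copy.
        ≡⟨ ∑-cong (suc s) (λ j j<n → split j (s≤s⁻¹ j<n)) ⟩
      ∑ (suc s) (λ j → d j + e j)
        ≡⟨ ∑-+ (suc s) d e ⟩
      ∑ (suc s) d + ∑ (suc s) e
        ≡⟨ cong₂ _+_ (trans (∑-only (suc s) (s≤s c≤s) (λ j _ j≢c → off j (j≢c ∘ sym))) on)
                     (∑-port s c (⟦_⟧ ∘ block X c) c≤s) ⟩
      cut k n (block X c) + card s (block X c) ∎
      where
      open ≡-Reasoning
      d e : ℕ → ℕ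
      d j = if c ≡ᵇ j then cut k n (block X c) else 0
      e j = if c ≡ᵇ j then 0 else ⟦ block X c (port c j) ⟧
      on : d c ≡ cut k n (block X c)
      on rewrite ≡ᵇ-refl c = refl
      off : ∀ j → c ≢ j → d j ≡ 0
      off j c≢j rewrite ≢⇒≡ᵇ c≢j = refl
      vanish : ∀ i j → i ≤ s → j ≤ s → i ≢ c → between X i j ≡ 0
      vanish i j i≤s j≤s i≢c with i ≟ j
      ... | yes refl = trans (between-same X i) (cut-false k n (block X i) (elsewhere i i≤s i≢c))
      ... | no i≢j   = trans (between-cross X i≢j)
        (cong (λ x → ⟦ x ∧ not (block X j (port j i)) ⟧)
          (elsewhere i i≤s i≢c (port i j) (port-bound i≤s j≤s i≢j)))
      split : ∀ j → j ≤ s → between X c j ≡ d j + e j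
      split j j≤s with c ≟ j
      ... | yes refl rewrite ≡ᵇ-refl c = sym (+-identityʳ _)
      ... | no c≢j rewrite ≢⇒≡ᵇ c≢j
        | elsewhere j j≤s (c≢j ∘ sym) (port j c) (port-bound j≤s c≤s (c≢j ∘ sym))
        = cong ⟦_⟧ (∧-identityʳ _)

-- Classification of vertex sets by how they meet the copies.

-- This is `(m - 1) * (n - 1) ≥ 0` without subtraction.
m+n≤1+m*n : ∀ {m n} → 1 ≤ m → 1 ≤ n → m + n ≤ 1 + m * n
m+n≤1+m*n {suc m} {suc n} _ _ = s≤s
  (≤-trans (≤-reflexive (+-comm m (suc n))) (+-monoʳ-≤ (suc n) (m≤m*n m (suc n))))

isZero : ℕ → ℕ
isZero zero    = 1
isZero (suc _) = 0

isZero* : ∀ x y {b} → (x ≡ 0 → y ≡ 0 → b ≡ true) → isZero x * isZero y ≤ ⟦ b ⟧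
isZero* zero    zero    p rewrite p refl refl = ≤-refl
isZero* zero    (suc y) p = z≤n
isZero* (suc x) y       p = z≤n

Proper : ℕ → (ℕ → Bool) → Set
Proper n X = 1 ≤ card n X × 1 ≤ card n (co X)

module _ (k n : ℕ) where
  open Blocks k n

  -- In use, `Y` is the trace of `X` on the one copy containing it. Keeping just the numerical
  -- consequences lets the index of that copy be forgotten.
  record ConcentratedAs (X Y : ℕ → Bool) : Set where
    field
      proper : Proper s Y
      cut≡   : cut (suc k) n X ≡ cut k n Y + card s Y
      card≡  : card (t (suc k) n) X ≡ card s Y

  -- Here `ℓ` stands for a lower bound on the cuts of proper vertex sets one level down. The
  -- cardinality in `balanced` serves the base case of `cut+card`.
  data Shape (ℓ : ℕ) (X : ℕ → Bool) : Set where
    spread         : ℓ + ℓ ≤ cut (suc k) n X → Shape ℓ X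
    balanced       : s ≤ cut (suc k) n X → s ≤ card (t (suc k) n) X → Shape ℓ X
    concentrated   : ∀ Y → ConcentratedAs X Y → Shape ℓ X
    coconcentrated : ∀ Y → ConcentratedAs (co X) Y → Shape ℓ X

  ∑cuts≤cut : ∀ X → ∑ (suc s) (λ i → cut k n (block X i)) ≤ cut (suc k) n X
  ∑cuts≤cut X = subst (∑ (suc s) (λ i → cut k n (block X i)) ≤_) (sym (cut-blocks X))
    (∑-mono (suc s) λ i i<n →
      ≤-trans (≤-reflexive (sym (between-same X i))) (term≤∑ (suc s) (between X i) i<n))

  module _ {ℓ} (ℓ≤cut : ∀ Y → Proper s Y → ℓ ≤ cut k n Y) where

    -- Without full copies, each copy that `X` meets is met properly. Two such copies have cuts of
    -- at least `ℓ` each; if there is only one, it contains `X`.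
    no-full-copy : ∀ X → 1 ≤ card (t (suc k) n) X →
      (∀ i → i < suc s → 1 ≤ card s (co (block X i))) →
      (ℓ + ℓ ≤ cut (suc k) n X) ⊎ (∃[ Y ] ConcentratedAs X Y)
    no-full-copy X 1≤X 1≤co
      with c , c<n , 1≤c ← ∑-positive (suc s) (λ i → card s (block X i)) (subst (1 ≤_) (card-blocks X) 1≤X)
      with anyUpTo? (λ j → ¬? (j ≟ c) ×-dec (1 ≤? card s (block X j))) (suc s)
    ... | yes (j , j<n , j≢c , 1≤j) = inj₁ (≤-trans
      (+-mono-≤ (ℓ≤cut (block X j) (1≤j , 1≤co j j<n)) (ℓ≤cut (block X c) (1≤c , 1≤co c c<n)))
      (≤-trans (two-terms≤∑ (suc s) (λ i → cut k n (block X i)) j<n c<n j≢c) (∑cuts≤cut X)))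
    ... | no ¬other = inj₂ (block X c , record
      { proper = 1≤c , 1≤co c c<n
      ; cut≡   = cut-concentrated
      ; card≡  = card-concentrated
      })
      where
      elsewhere : ∀ i → i ≤ s → i ≢ c → ∀ a → a < s → block X i a ≡ false
      elsewhere i i≤s i≢c = card≡0⇒false s (block X i)
        (n<1⇒n≡0 (≰⇒> λ 1≤i → ¬other (i , s≤s i≤s , i≢c , 1≤i)))
      open Concentrated X (s≤s⁻¹ c<n) elsewhere

    -- Let `p` copies be full and `q` empty, and let `M` be the sum of the cuts inside the copies.
    -- The edges between full and empty copies give `p * q + M` boundary edges in all. As `M` is at
    -- least the number of remaining copies, `s + 1 ≤ p + q + M`, and `p + q ≤ 1 + p * q` finishes.
    -- One full copy accounts for the cardinality.
    full-and-empty-copy : 1 ≤ ℓ → 1 ≤ s → ∀ X {i j} → i < suc s → j < suc s →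
      card s (co (block X i)) ≡ 0 → card s (block X j) ≡ 0 →
      s ≤ cut (suc k) n X × s ≤ card (t (suc k) n) X
    full-and-empty-copy 1≤ℓ 1≤s X {i₀} {j₀} i₀<n j₀<n full₀ empty₀ = s≤cut , s≤card
      where
      full empty mixed : ℕ → ℕ
      full  i = isZero (card s (co (block X i)))
      empty i = isZero (card s (block X i))
      mixed i = cut k n (block X i)
      p q M : ℕ
      p = ∑ (suc s) full
      q = ∑ (suc s) empty
      M = ∑ (suc s) mixed

      1≤p : 1 ≤ p
      1≤p = ≤-trans (≤-reflexive (sym (cong isZero full₀))) (term≤∑ (suc s) full i₀<n)

      1≤q : 1 ≤ q
      1≤q = ≤-trans (≤-reflexive (sym (cong isZero empty₀))) (term≤∑ (suc s) empty j₀<n)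

      -- A copy that is neither full nor empty is met properly, so its cut is at least `ℓ`, hence
      -- positive.
      classify : ∀ i → 1 ≤ full i + empty i + mixed i
      classify i with card s (co (block X i)) in f | card s (block X i) in e
      ... | zero  | _     = s≤s z≤n
      ... | suc _ | zero  = s≤s z≤n
      ... | suc _ | suc _ = ≤-trans 1≤ℓ (ℓ≤cut (block X i)
        (subst (1 ≤_) (sym e) (s≤s z≤n) , subst (1 ≤_) (sym f) (s≤s z≤n)))

      1+s≤p+q+M : suc s ≤ p + q + M
      1+s≤p+q+M = begin
        suc s                                          ≡⟨ *-identityʳ (suc s) ⟨
        suc s * 1                                      ≡⟨ ∑-const (suc s) 1 ⟨
        ∑ (suc s) (λ _ → 1)                            ≤⟨ ∑-mono (suc s) (λ i _ → classify i) ⟩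
        ∑ (suc s) (λ i → full i + empty i + mixed i)   ≡⟨ ∑-+ (suc s) (λ i → full i + empty i) mixed ⟩
        ∑ (suc s) (λ i → full i + empty i) + M         ≡⟨ cong (_+ M) (∑-+ (suc s) full empty) ⟩
        p + q + M                                      ∎
        where open ≤-Reasoning

      d : ℕ → ℕ → ℕ
      d i j = if i ≡ᵇ j then mixed i else 0

      d-same : ∀ i → d i i ≡ mixed i
      d-same i rewrite ≡ᵇ-refl i = refl

      -- A copy both full and empty would have no vertices. So the products count only pairs of
      -- distinct copies and leave the diagonal to `d`.
      full*empty≡0 : ∀ i → full i * empty i ≡ 0
      full*empty≡0 i with card s (co (block X i)) | card s (block X i) | card-co s (block X i)
      ... | suc _ | _     | _   = refl
      ... | zero  | suc _ | _   = refl
      ... | zero  | zero  | 0≡s = contradiction (subst (1 ≤_) (sym 0≡s) 1≤s) λ ()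

      pointwise : ∀ i → i ≤ s → ∀ j → j ≤ s → full i * empty j + d i j ≤ between X i j
      pointwise i i≤s j j≤s with i ≟ j
      ... | yes refl = ≤-reflexive (trans (cong₂ _+_ (full*empty≡0 i) (d-same i)) (sym (between-same X i)))
      ... | no i≢j rewrite ≢⇒≡ᵇ i≢j | +-identityʳ (full i * empty j) =
        isZero* (card s (co (block X i))) (card s (block X j)) λ f e →
          cong₂ (λ x y → x ∧ not y)
            (card-co≡0⇒true s (block X i) f (port i j) (port-bound i≤s j≤s i≢j))
            (card≡0⇒false s (block X j) e (port j i) (port-bound j≤s i≤s (i≢j ∘ sym)))

      p*q+M≤cut : p * q + M ≤ cut (suc k) n X
      p*q+M≤cut = begin
        p * q + M
          ≡⟨ cong₂ _+_ (sym (trans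
               (∑-cong (suc s) λ i _ → ∑-*ˡ (suc s) (full i) empty)
               (∑-*ʳ (suc s) full q)))
             (sym (∑-cong (suc s) λ i i<n → trans
               (∑-only (suc s) i<n λ j _ j≢i → cong (if_then mixed i else 0) (≢⇒≡ᵇ (j≢i ∘ sym)))
               (d-same i))) ⟩
        ∑ (suc s) (λ i → ∑ (suc s) λ j → full i * empty j) + ∑ (suc s) (λ i → ∑ (suc s) (d i))
          ≡⟨ ∑-+ (suc s) (λ i → ∑ (suc s) λ j → full i * empty j) (λ i → ∑ (suc s) (d i)) ⟨
        ∑ (suc s) (λ i → ∑ (suc s) (λ j → full i * empty j) + ∑ (suc s) (d i))
          ≡⟨ ∑-cong (suc s) (λ i _ → ∑-+ (suc s) (λ j → full i * empty j) (d i)) ⟨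
        ∑ (suc s) (λ i → ∑ (suc s) λ j → full i * empty j + d i j)
          ≤⟨ ∑-mono₂ (suc s) (suc s) (λ i i<n j j<n → pointwise i (s≤s⁻¹ i<n) j (s≤s⁻¹ j<n)) ⟩
        ∑ (suc s) (λ i → ∑ (suc s) (between X i))
          ≡⟨ cut-blocks X ⟨
        cut (suc k) n X ∎
        where open ≤-Reasoning

      s≤cut : s ≤ cut (suc k) n X
      s≤cut = ≤-trans
        (s≤s⁻¹ (≤-trans 1+s≤p+q+M (+-monoˡ-≤ M (m+n≤1+m*n 1≤p 1≤q)))) p*q+M≤cut

      s≤card : s ≤ card (t (suc k) n) X
      s≤card = begin
        s                                         ≡⟨ card-co s (block X i₀) ⟨
        card s (block X i₀) + card s (co (block X i₀))  ≡⟨ cong (card s (block X i₀) +_) full₀ ⟩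
        card s (block X i₀) + 0                   ≡⟨ +-identityʳ _ ⟩
        card s (block X i₀)                       ≤⟨ term≤∑ (suc s) (λ i → card s (block X i)) i₀<n ⟩
        ∑ (suc s) (λ i → card s (block X i))      ≡⟨ card-blocks X ⟨
        card (t (suc k) n) X                      ∎
        where open ≤-Reasoning

    shape : 1 ≤ ℓ → 1 ≤ s → ∀ X → Proper (t (suc k) n) X → Shape ℓ X
    shape 1≤ℓ 1≤s X (1≤X , 1≤coX)
      with anyUpTo? (λ i → card s (co (block X i)) ≟ 0) (suc s)
    ... | no ¬full with no-full-copy X 1≤X (λ i i<n → n≢0⇒n>0 λ f → ¬full (i , i<n , f))
    ...   | inj₁ 2ℓ≤cut = spread 2ℓ≤cut
    ...   | inj₂ (Y , c) = concentrated Y c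
    shape 1≤ℓ 1≤s X (1≤X , 1≤coX)
        | yes (i , i<n , full)
      with anyUpTo? (λ j → card s (block X j) ≟ 0) (suc s)
    ... | yes (j , j<n , empty)
      with a , b ← full-and-empty-copy 1≤ℓ 1≤s X i<n j<n full empty = balanced a b
    ... | no ¬empty
      -- An empty copy of `X` is a full copy of `co X`; the double complement arising here is
      -- removed by `not-involutive`.
      with no-full-copy (co X) 1≤coX (λ i i<n → n≢0⇒n>0 λ e → ¬empty
             (i , i<n , trans (∑-cong s λ a _ → cong ⟦_⟧ (sym (not-involutive (block X i a)))) e))
    ...   | inj₁ 2ℓ≤cut = spread (subst (ℓ + ℓ ≤_) (cut-co (suc k) n X) 2ℓ≤cut)
    ...   | inj₂ (Y , c) = coconcentrated Y c

-- Sizes of edge sets compared with cuts of vertex sets.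

sum-allFin : ∀ {n} (f : Fin n → ℕ) → List.sum (map f (allFin n)) ≡ sum f
sum-allFin f = trans (cong List.sum (map-tabulate id f)) (sum-tabulate f)
  where
  sum-tabulate : ∀ {n} (f : Fin n → ℕ) → List.sum (tabulate f) ≡ sum f
  sum-tabulate {zero}  f = refl
  sum-tabulate {suc n} f = cong (f Fin.zero +_) (sum-tabulate (f ∘ Fin.suc))

-- The summands of `size` involve a function local to its definition, which
-- can only be reached by unification.
size-summand : (G : Graph) (F : EdgeSet G) → Σ (Fin (N G) → Fin (N G) → ℕ) λ h →
  size G F ≡ List.sum (map (λ u → List.sum (map (λ v → h u v) (allFin (N G)))) (allFin (N G)))
size-summand G F = _ , refl

size≡sum : (G : Graph) (F : EdgeSet G) →
  size G F ≡ sum λ u → sum λ v → ⟦ (toℕ u <ᵇ toℕ v) ∧ inF G F u v ⟧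
size≡sum G F = trans (sum-allFin {N G} _) (sum-cong-≗ {N G} λ u →
  trans (sum-allFin {N G} _) (sum-cong-≗ {N G} (summand u)))
  where
  summand : ∀ u v → proj₁ (size-summand G F) u v ≡ ⟦ (toℕ u <ᵇ toℕ v) ∧ inF G F u v ⟧
  summand u v with (toℕ u <ᵇ toℕ v) ∧ inF G F u v
  ... | true  = refl
  ... | false = refl

boundary : ∀ k n → (ℕ → Bool) → EdgeSet (DCell k n)
boundary k n X u v = X (toℕ u) ∧ not (X (toℕ v))

⟦⟧-mono : ∀ {a b} → (T a → T b) → ⟦ a ⟧ ≤ ⟦ b ⟧
⟦⟧-mono {false}         _   = z≤n
⟦⟧-mono {true}  {true}  _   = ≤-refl
⟦⟧-mono {true}  {false} a⇒b = contradiction (a⇒b _) λ ()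

-- `size` orders the ends of an edge by number, `cut` by membership in `X`. Boundary edges are
-- sorted by whether the end in `X` is the smaller (`up`) or the larger (`down`); exchanging the two
-- sums for `down` matches the counts.
size-boundary : ∀ k n X → size (DCell k n) (boundary k n X) ≡ cut k n X
size-boundary k n X = begin
  size (DCell k n) (boundary k n X)
    ≡⟨ size≡sum (DCell k n) (boundary k n X) ⟩
  ∑ s (λ u → ∑ s λ v → ⟦ (u <ᵇ v) ∧ dadj k n u v ∧ ((X u ∧ not (X v)) ∨ (X v ∧ not (X u))) ⟧)
    ≡⟨ ∑-cong₂ s s (λ u _ v _ → orient u v) ⟩
  ∑ s (λ u → ∑ s λ v → up u v + down v u)
    ≡⟨ ∑-cong s (λ u _ → ∑-+ s (up u) (λ v → down v u)) ⟩
  ∑ s (λ u → ∑ s (up u) + ∑ s (λ v → down v u))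
    ≡⟨ ∑-+ s (λ u → ∑ s (up u)) (λ u → ∑ s (λ v → down v u)) ⟩
  ∑ s (λ u → ∑ s (up u)) + ∑ s (λ u → ∑ s (λ v → down v u))
    ≡⟨ cong (∑ s (λ u → ∑ s (up u)) +_) (∑-swap s s (λ u v → down v u)) ⟩
  ∑ s (λ u → ∑ s (up u)) + ∑ s (λ u → ∑ s (down u))
    ≡⟨ ∑-+ s (λ u → ∑ s (up u)) (λ u → ∑ s (down u)) ⟨
  ∑ s (λ u → ∑ s (up u) + ∑ s (down u))
    ≡⟨ ∑-cong s (λ u _ → ∑-+ s (up u) (down u)) ⟨
  ∑ s (λ u → ∑ s λ v → up u v + down u v)
    ≡⟨ ∑-cong₂ s s (λ u _ v _ → merge u v) ⟩
  cut k n X ∎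
  where
  open ≡-Reasoning
  s = t k n
  leaves : ℕ → ℕ → Bool
  leaves u v = X u ∧ not (X v) ∧ dadj k n u v
  up down : ℕ → ℕ → ℕ
  up   u v = ⟦ (u <ᵇ v) ∧ leaves u v ⟧
  down u v = ⟦ (v <ᵇ u) ∧ leaves u v ⟧
  lem : ∀ l e x y → ⟦ l ∧ e ∧ ((x ∧ not y) ∨ (y ∧ not x)) ⟧
    ≡ ⟦ l ∧ x ∧ not y ∧ e ⟧ + ⟦ l ∧ y ∧ not x ∧ e ⟧
  lem false e     x     y     = refl
  lem true  false false false = refl
  lem true  false false true  = refl
  lem true  false true  false = refl
  lem true  false true  true  = refl
  lem true  true  false false = refl
  lem true  true  false true  = refl
  lem true  true  true  false = refl
  lem true  true  true  true  = refl
  orient : ∀ u v →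
    ⟦ (u <ᵇ v) ∧ dadj k n u v ∧ ((X u ∧ not (X v)) ∨ (X v ∧ not (X u))) ⟧ ≡ up u v + down v u
  orient u v = trans (lem (u <ᵇ v) (dadj k n u v) (X u) (X v))
    (cong (λ e → up u v + ⟦ (u <ᵇ v) ∧ X v ∧ not (X u) ∧ e ⟧) (dadj-sym k n u v))
  merge : ∀ u v → up u v + down u v ≡ ⟦ leaves u v ⟧
  merge u v with <-cmp u v
  ... | tri< u<v _ _ rewrite <⇒<ᵇ-true u<v | ≤⇒<ᵇ-false (<⇒≤ u<v) = +-identityʳ _
  ... | tri> _ _ v<u rewrite <⇒<ᵇ-true v<u | ≤⇒<ᵇ-false (<⇒≤ v<u) = refl
  ... | tri≈ _ refl _ rewrite ≤⇒<ᵇ-false (≤-refl {u}) with X u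
  ...   | true  = refl
  ...   | false = refl

cut≤size : ∀ k n X (F : EdgeSet (DCell k n)) →
  (∀ u v → T (X (toℕ u)) → T (not (X (toℕ v))) → T (adj (DCell k n) u v) → T (F u v ∨ F v u)) →
  cut k n X ≤ size (DCell k n) F
cut≤size k n X F boundary⊆F = begin
  cut k n X                          ≡⟨ size-boundary k n X ⟨
  size G (boundary k n X)            ≡⟨ size≡sum G (boundary k n X) ⟩
  (sum λ u → sum λ v → ⟦ (toℕ u <ᵇ toℕ v) ∧ inF G (boundary k n X) u v ⟧)
    ≤⟨ sum-mono (λ u → sum-mono λ v → ⟦⟧-mono (λ p →
         let u<v , q = to (T-∧ {toℕ u <ᵇ toℕ v}) p ; e , b = to (T-∧ {adj G u v}) q in
         from (T-∧ {toℕ u <ᵇ toℕ v}) (u<v , from T-∧ (e , inc u v e (to T-∨ b))))) ⟩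
  (sum λ u → sum λ v → ⟦ (toℕ u <ᵇ toℕ v) ∧ inF G F u v ⟧)
    ≡⟨ size≡sum G F ⟨
  size G F ∎
  where
  open ≤-Reasoning
  open Equivalence
  G = DCell k n
  inc : ∀ u v → T (adj G u v) → T (boundary k n X u v) ⊎ T (boundary k n X v u) → T (F u v ∨ F v u)
  inc u v e (inj₁ b) = let x , y = to T-∧ b in boundary⊆F u v x y e
  inc u v e (inj₂ b) = let x , y = to T-∧ b in subst T (∨-comm (F v u) (F u v))
    (boundary⊆F v u x y (subst T (dadj-sym k n (toℕ u) (toℕ v)) e))

-- Components after the removal of an edge set.

reach-trans : ∀ {G F u v w} → Reach G F u v → Reach G F v w → Reach G F u w
reach-trans r here       = r
reach-trans r (step q e) = step (reach-trans r q) e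

reach-sym : ∀ k n {F u v} → Reach (DCell k n) F u v → Reach (DCell k n) F v u
reach-sym k n here = here
reach-sym k n {F} (step {v} {w} r e) = reach-trans (step here e′) (reach-sym k n r)
  where
  e′ : T (adjMinus (DCell k n) F w v)
  e′ = subst T (cong₂ (λ x y → x ∧ not y) (dadj-sym k n (toℕ v) (toℕ w)) (∨-comm (F v w) (F w v))) e

extend : ∀ {n} → (Fin n → Bool) → ℕ → Bool
extend {n} P i with i <? n
... | yes i<n = P (fromℕ< i<n)
... | no  _   = false

extend-toℕ : ∀ {n} (P : Fin n → Bool) i → extend P (toℕ i) ≡ P i
extend-toℕ {n} P i with toℕ i <? n
... | yes i<n = cong P (fromℕ<-toℕ i i<n)
... | no  i≮n = contradiction (toℕ<n i) i≮n

2≤card : ∀ {n} X {i j : Fin n} → i ≢ j → X (toℕ i) ≡ true → X (toℕ j) ≡ true → 2 ≤ card n X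
2≤card {n} X {i} {j} i≢j Xi Xj = subst₂ (λ x y → ⟦ x ⟧ + ⟦ y ⟧ ≤ card n X) Xi Xj
  (two-terms≤∑ n (⟦_⟧ ∘ X) (toℕ<n i) (toℕ<n j) (i≢j ∘ toℕ-injective))

-- The component of u₀ need not be a decidable set, but ≤ on ℕ is stable under
-- double negation, so reachability from u₀ may be assumed decidable.
cut-of-component : ∀ k n F {c} →
  (∀ X → 2 ≤ card (t k n) X → 2 ≤ card (t k n) (co X) → c ≤ cut k n X) →
  IsRestrictedCut 2 (DCell k n) F → c ≤ size (DCell k n) F
cut-of-component k n F {c} c≤cut ((u₀ , v₀ , ¬u₀~v₀) , large) =
  decidable-stable (c ≤? size G F) (¬¬-map bound
    -- `sequence` moves the double negation past the quantifier over the finitely many vertices.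
    (sequence (RawMonad.rawApplicative ¬¬-Monad) λ v → ¬¬-excluded-middle))
  where
  G = DCell k n
  bound : (∀ v → Dec (Reach G F u₀ v)) → c ≤ size G F
  bound reach? = ≤-trans (c≤cut X 2≤X 2≤coX) (cut≤size k n X F closed)
    where
    X : ℕ → Bool
    X = extend (does ∘ reach?)
    X-true : ∀ {v} → Reach G F u₀ v → X (toℕ v) ≡ true
    X-true {v} r = trans (extend-toℕ (does ∘ reach?) v) (dec-true (reach? v) r)
    X-false : ∀ {v} → ¬ Reach G F u₀ v → X (toℕ v) ≡ false
    X-false {v} ¬r = trans (extend-toℕ (does ∘ reach?) v) (dec-false (reach? v) ¬r)
    closed : ∀ u v → T (X (toℕ u)) → T (not (X (toℕ v))) → T (adj G u v) → T (F u v ∨ F v u)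
    closed u v Xu ¬Xv e with F u v ∨ F v u in Fuv
    ... | true  = _
    -- An edge outside `F` that leaves the component of `u₀` would put its far end into that
    -- component.
    ... | false with reach? u
    ...   | no ¬r = subst T (X-false ¬r) Xu
    ...   | yes r = subst (T ∘ not) (X-true {v} (step r
      (Equivalence.from T-∧ (e , subst (T ∘ not) (sym Fuv) _)))) ¬Xv
    2≤X : 2 ≤ card (t k n) X
    2≤X with f , inj , r ← large u₀ =
      2≤card X (λ eq → contradiction (inj eq) λ ()) (X-true (r Fin.zero)) (X-true (r (Fin.suc Fin.zero)))
    2≤coX : 2 ≤ card (t k n) (co X)
    2≤coX with f , inj , r ← large v₀ =
      2≤card (co X) (λ eq → contradiction (inj eq) λ ()) (out Fin.zero) (out (Fin.suc Fin.zero))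
      where
      -- The component of `v₀` is disjoint from that of `u₀`, so its two vertices lie outside `X`.
      out : ∀ i → co X (toℕ (f i)) ≡ true
      out i = cong not (X-false λ q → ¬u₀~v₀ (reach-trans q (reach-sym k n (r i))))

reach-boundary : ∀ k n X {u v} → Reach (DCell k n) (boundary k n X) u v → X (toℕ u) ≡ X (toℕ v)
reach-boundary k n X here = refl
reach-boundary k n X (step {v} {w} r e) =
  trans (reach-boundary k n X r) (lem (X (toℕ v)) (X (toℕ w)) (proj₂ (Equivalence.to T-∧ e)))
  where
  lem : ∀ x y → T (not ((x ∧ not y) ∨ (y ∧ not x))) → x ≡ y
  lem true  true  _ = refl
  lem false false _ = refl

boundary-edge : ∀ k n X u v → T (dadj k n (toℕ u) (toℕ v)) → X (toℕ u) ≡ X (toℕ v) →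
  Reach (DCell k n) (boundary k n X) u v
boundary-edge k n X u v e eq =
  step here (Equivalence.from T-∧ (e , lem (X (toℕ u)) (X (toℕ v)) eq))
  where
  lem : ∀ x y → x ≡ y → T (not ((x ∧ not y) ∨ (y ∧ not x)))
  lem true  .true  refl = _
  lem false .false refl = _

-- The ends of an edge of the first copy of `D_0`. They are numbered 0 and 1 at every level, since
-- copy 0 keeps its numbering.
first2 : ℕ → Bool
first2 u = u <ᵇ 2

-- Lower bounds for cuts, by induction on the level.

module _ (m : ℕ) where

  private
    -- With `n` written as `2 + m`, the bounds need no truncated subtraction.
    n : ℕ
    n = 2 + m

  open ConcentratedAs

  n+k≤t : ∀ k → n + k ≤ t k n
  n+k≤t zero    = ≤-reflexive (+-identityʳ n)
  n+k≤t (suc k) = begin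
    n + suc k          ≡⟨ +-suc n k ⟩
    suc (n + k)        ≤⟨ s≤s (n+k≤t k) ⟩
    suc (t k n)        ≡⟨ +-comm 1 (t k n) ⟩
    t k n + 1          ≤⟨ m≤n*m (t k n + 1) (t k n) {{>-nonZero (≤-trans (s≤s z≤n) (n+k≤t k))}} ⟩
    t k n * (t k n + 1) ∎
    where open ≤-Reasoning

  1≤t : ∀ k → 1 ≤ t k n
  1≤t k = ≤-trans (s≤s z≤n) (n+k≤t k)

  2*[n+k]≤t : ∀ k → 2 * (n + k) ≤ t (suc k) n
  2*[n+k]≤t k = ≤-trans (≤-reflexive (*-comm 2 (n + k)))
    (*-mono-≤ (n+k≤t k) (≤-trans (s≤s (1≤t k)) (≤-reflexive (+-comm 1 (t k n)))))

  -- The bound is the degree `n - 1 + k` of a vertex. Going up one level must gain 1: a concentrated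
  -- set gains its cardinality, two properly met copies give `ℓ + ℓ` with `ℓ` positive, and a
  -- balanced set already has `t k n` boundary edges.
  edge-connectivity : ∀ k X → Proper (t k n) X → suc (m + k) ≤ cut k n X
  edge-connectivity zero X (1≤X , 1≤coX) = s≤s⁻¹ (begin
    suc (suc m + 0)                ≡⟨ +-identityʳ n ⟩
    n                              ≡⟨ card-co n X ⟨
    card n X + card n (co X)       ≤⟨ m+n≤1+m*n 1≤X 1≤coX ⟩
    suc (card n X * card n (co X)) ≡⟨ cong suc (cut₀ n X) ⟨
    suc (cut 0 n X)                ∎)
    where open ≤-Reasoning
  edge-connectivity (suc k) X PX = subst (λ l → suc l ≤ cut (suc k) n X) (sym (+-suc m k)) bound
    where
    ℓ+1≤ : ∀ Y → Proper (t k n) Y → suc (suc (m + k)) ≤ cut k n Y + card (t k n) Y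
    ℓ+1≤ Y PY = ≤-trans (≤-reflexive (+-comm 1 (suc (m + k))))
      (+-mono-≤ (edge-connectivity k Y PY) (proj₁ PY))
    bound : suc (suc (m + k)) ≤ cut (suc k) n X
    bound with shape k n (edge-connectivity k) (s≤s z≤n) (1≤t k) X PX
    ... | spread 2ℓ≤cut = ≤-trans (+-monoˡ-≤ (suc (m + k)) (s≤s {0} z≤n)) 2ℓ≤cut
    ... | balanced s≤cut _ = ≤-trans (n+k≤t k) s≤cut
    ... | concentrated Y c = subst (suc (suc (m + k)) ≤_) (sym (cut≡ c)) (ℓ+1≤ Y (proper c))
    ... | coconcentrated Y c = subst (suc (suc (m + k)) ≤_) (trans (sym (cut≡ c)) (cut-co (suc k) n X))
      (ℓ+1≤ Y (proper c))

  -- At level 1 the analogue of restricted-bound fails, since a copy of K_n is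
  -- left by only n edges; adding the cardinality repairs the induction.
  cut+card : ∀ k X → 2 ≤ card (t (suc k) n) X → 1 ≤ card (t (suc k) n) (co X) →
    2 * (n + k) ≤ cut (suc k) n X + card (t (suc k) n) X
  -- A set inside one copy may miss just one vertex of that copy, which is why `cut+card` asks for
  -- only one vertex in the complement. The two inductions call each other, and `k` drops each time
  -- `cut+card` calls back.
  restricted-bound : ∀ k X → 2 ≤ card (t (2 + k) n) X → 2 ≤ card (t (2 + k) n) (co X) →
    2 * (n + k) ≤ cut (2 + k) n X

  cut+card zero X 2≤X 1≤coX
    rewrite +-identityʳ m
    with shape 0 n (edge-connectivity 0) (s≤s z≤n) (1≤t 0) X (≤-trans (s≤s z≤n) 2≤X , 1≤coX)
  ... | spread 2ℓ≤cut = ≤-trans (≤-reflexive (lem m)) (+-mono-≤ 2ℓ≤cut 2≤X)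
    where
    lem : ∀ m → 2 * (2 + m) ≡ (suc (m + 0) + suc (m + 0)) + 2
    lem = solve-∀
  ... | balanced s≤cut s≤X = ≤-trans (≤-reflexive (cong (n +_) (+-identityʳ n))) (+-mono-≤ s≤cut s≤X)
  -- With `a` vertices of a `K_n` chosen and `b` missing, cut and cardinality add up to
  -- `(a * b + a) + a`, which is at least `2 * (a + b)` because `a ≥ 2`.
  ... | concentrated Y c = begin
    2 * n                                   ≡⟨ cong (2 *_) (card-co n Y) ⟨
    2 * (a + b)                             ≡⟨ lem₁ a b ⟩
    2 * b + (a + a)                         ≤⟨ +-monoˡ-≤ (a + a) (*-monoˡ-≤ b (subst (2 ≤_) (card≡ c) 2≤X)) ⟩
    a * b + (a + a)                         ≡⟨ +-assoc (a * b) a a ⟨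
    a * b + a + a                           ≡⟨ cong₂ (λ x y → x + a + y) (sym (cut₀ n Y)) (sym (card≡ c)) ⟩
    cut 0 n Y + a + card (t 1 n) X          ≡⟨ cong (_+ card (t 1 n) X) (cut≡ c) ⟨
    cut 1 n X + card (t 1 n) X              ∎
    where
    open ≤-Reasoning
    a = card n Y
    b = card n (co Y)
    lem₁ : ∀ a b → 2 * (a + b) ≡ 2 * b + (a + a)
    lem₁ = solve-∀
  -- The complement consists of `a ≤ n` vertices of one `K_n`. So the cut is `a * b + a ≥ n`, and
  -- `X` keeps at least `n` of the `n * (n + 1)` vertices.
  ... | coconcentrated Y c = begin
    2 * n                                   ≡⟨ cong (n +_) (+-identityʳ n) ⟩
    n + n                                   ≤⟨ +-mono-≤ n≤cut n≤card ⟩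
    cut 1 n X + card (t 1 n) X              ∎
    where
    open ≤-Reasoning
    a = card n Y
    b = card n (co Y)
    a≤n : a ≤ n
    a≤n = m+n≤o⇒m≤o a (≤-reflexive (card-co n Y))
    n≤cut : n ≤ cut 1 n X
    n≤cut = begin
      n               ≡⟨ card-co n Y ⟨
      a + b           ≤⟨ m+n≤1+m*n (proj₁ (proper c)) (proj₂ (proper c)) ⟩
      1 + a * b       ≡⟨ +-comm 1 (a * b) ⟩
      a * b + 1       ≤⟨ +-monoʳ-≤ (a * b) (proj₁ (proper c)) ⟩
      a * b + a       ≡⟨ cong (_+ a) (cut₀ n Y) ⟨
      cut 0 n Y + a   ≡⟨ cut≡ c ⟨
      cut 1 n (co X)  ≡⟨ cut-co 1 n X ⟩
      cut 1 n X       ∎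
    n≤card : n ≤ card (t 1 n) X
    n≤card = +-cancelʳ-≤ a n _ (begin
      n + a                                       ≤⟨ +-monoʳ-≤ n a≤n ⟩
      n + n                                       ≤⟨ +-monoˡ-≤ n (m≤m*n n n) ⟩
      n * n + n                                   ≡⟨ cong (n * n +_) (*-identityʳ n) ⟨
      n * n + n * 1                               ≡⟨ *-distribˡ-+ n n 1 ⟨
      t 1 n                                       ≡⟨ card-co (t 1 n) X ⟨
      card (t 1 n) X + card (t 1 n) (co X)        ≡⟨ cong (card (t 1 n) X +_) (card≡ c) ⟩
      card (t 1 n) X + a                          ∎)
  cut+card (suc k) X 2≤X 1≤coX with 2 ≤? card (t (2 + k) n) (co X)
  ... | yes 2≤coX = ≤-trans (≤-reflexive (lem n k)) (+-mono-≤ (restricted-bound k X 2≤X 2≤coX) 2≤X)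
    where
    lem : ∀ n k → 2 * (n + suc k) ≡ 2 * (n + k) + 2
    lem = solve-∀
  -- The complement is a single vertex. Both the cut and the cardinality, which is one less than
  -- `t (2 + k) n`, reach half of the required sum.
  ... | no ¬2≤coX = begin
    2 * (n + suc k)                    ≡⟨ lem m k ⟩
    suc (m + (2 + k)) + suc (m + (2 + k))
      ≤⟨ +-mono-≤ (edge-connectivity (2 + k) X (≤-trans (s≤s z≤n) 2≤X , 1≤coX)) (s≤s⁻¹ (begin
           n + (2 + k)                                         ≤⟨ n+k≤t (2 + k) ⟩
           t (2 + k) n                                         ≡⟨ card-co (t (2 + k) n) X ⟨
           card (t (2 + k) n) X + card (t (2 + k) n) (co X)    ≤⟨ +-monoʳ-≤ _ (s≤s⁻¹ (≰⇒> ¬2≤coX)) ⟩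
           card (t (2 + k) n) X + 1                            ≡⟨ +-comm _ 1 ⟩
           suc (card (t (2 + k) n) X)                          ∎)) ⟩
    cut (2 + k) n X + card (t (2 + k) n) X ∎
    where
    open ≤-Reasoning
    lem : ∀ m k → 2 * (2 + m + suc k) ≡ suc (m + (2 + k)) + suc (m + (2 + k))
    lem = solve-∀

  restricted-bound k X 2≤X 2≤coX
    with shape (suc k) n (edge-connectivity (suc k)) (s≤s z≤n) (1≤t (suc k)) X
           (≤-trans (s≤s z≤n) 2≤X , ≤-trans (s≤s z≤n) 2≤coX)
  ... | spread 2ℓ≤cut = ≤-trans (≤-reflexive (lem m k)) 2ℓ≤cut
    where
    lem : ∀ m k → 2 * (2 + m + k) ≡ suc (m + suc k) + suc (m + suc k)
    lem = solve-∀
  ... | balanced s≤cut _ = ≤-trans (2*[n+k]≤t k) s≤cut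
  ... | concentrated Y c = subst (2 * (n + k) ≤_) (sym (cut≡ c))
    (cut+card k Y (subst (2 ≤_) (card≡ c) 2≤X) (proj₂ (proper c)))
  ... | coconcentrated Y c = subst (2 * (n + k) ≤_) (trans (sym (cut≡ c)) (cut-co (2 + k) n X))
    (cut+card k Y (subst (2 ≤_) (card≡ c) 2≤coX) (proj₂ (proper c)))

  -- An optimal restricted edge-cut.

  2≤t : ∀ k → 2 ≤ t k n
  2≤t k = ≤-trans (s≤s (s≤s z≤n)) (n+k≤t k)

  module _ (k : ℕ) where
    private
      s = t k n
      elsewhere : ∀ i → i ≤ s → i ≢ 0 → ∀ a → a < s → first2 (i * s + a) ≡ false
      elsewhere zero    _ i≢0 = contradiction refl i≢0
      elsewhere (suc i) _ _   a _ = ≤⇒<ᵇ-false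
        (≤-trans (2≤t k) (≤-trans (m≤m+n s (i * s)) (m≤m+n (s + i * s) a)))
    -- Since `0 * s + a` reduces to `a`, the trace of `first2` on copy 0 is `first2` one level down,
    -- so the next two proofs can recurse.
    open Blocks.Concentrated k n first2 z≤n elsewhere public

  card-first2 : ∀ k → card (t k n) first2 ≡ 2
  card-first2 zero    = cong (2 +_) (∑-zero m λ _ _ → refl)
  card-first2 (suc k) = trans (card-concentrated k) (card-first2 k)

  -- In `K_n` the pair is left by `2 * m` edges, and each level adds one edge at each of its two
  -- vertices.
  cut-first2 : ∀ k → cut k n first2 ≡ 2 * (m + k)
  cut-first2 zero = begin
    cut 0 n first2                              ≡⟨ cut₀ n first2 ⟩
    card n first2 * card n (co first2)          ≡⟨ cong₂ _*_ (card-first2 0) card-co≡m ⟩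
    2 * m                                       ≡⟨ cong (2 *_) (+-identityʳ m) ⟨
    2 * (m + 0)                                 ∎
    where
    open ≡-Reasoning
    card-co≡m : card n (co first2) ≡ m
    card-co≡m = +-cancelˡ-≡ 2 _ m (trans (cong (_+ card n (co first2)) (sym (card-first2 0))) (card-co n first2))
  cut-first2 (suc k) = begin
    cut (suc k) n first2               ≡⟨ cut-concentrated k ⟩
    cut k n first2 + card (t k n) first2 ≡⟨ cong₂ _+_ (cut-first2 k) (card-first2 k) ⟩
    2 * (m + k) + 2                    ≡⟨ lem m k ⟩
    2 * (m + suc k)                    ∎
    where
    open ≡-Reasoning
    lem : ∀ m k → 2 * (m + k) + 2 ≡ 2 * (m + suc k)
    lem = solve-∀

  dadj-01 : ∀ k → dadj k n 0 1 ≡ true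
  dadj-01 zero    = refl
  dadj-01 (suc k) = trans (Blocks.dadj-same k n 0 (1≤t k) (2≤t k)) (dadj-01 k)

  -- The degree of `u` is the cut of the singleton of `u`, hence at least 3 by `edge-connectivity`
  -- and `2 ≤ k`, while the pair can absorb only two neighbours. The conjunct `not (v ≡ᵇ u)` is how
  -- that cut presents a neighbour.
  neighbour-outside : ∀ k → 2 ≤ k → ∀ u → u < t k n →
    ∃[ v ] (v < t k n × T (not (v ≡ᵇ u) ∧ dadj k n u v) × T (not (first2 v)))
  neighbour-outside k 2≤k u u<s =
    decidable-stable (anyUpTo? (λ v → T? (not (v ≡ᵇ u) ∧ dadj k n u v) ×-dec T? (not (first2 v))) s)
      λ none → <⇒≱ 2<degree (≤-trans (∑-mono s λ v v<s → ⟦⟧-mono (inside none v v<s))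
        (≤-reflexive (card-first2 k)))
    where
    open ≤-Reasoning
    s = t k n
    single : ℕ → Bool
    single v = v ≡ᵇ u
    neighbour : ℕ → Bool
    neighbour v = not (v ≡ᵇ u) ∧ dadj k n u v
    card-single : card s single ≡ 1
    card-single = trans (∑-only s u<s λ v _ v≢u → cong ⟦_⟧ (≢⇒≡ᵇ v≢u)) (cong ⟦_⟧ (≡ᵇ-refl u))
    single-proper : Proper s single
    single-proper = ≤-reflexive (sym card-single) , s≤s⁻¹ (begin
      2                                  ≤⟨ 2≤t k ⟩
      s                                  ≡⟨ card-co s single ⟨
      card s single + card s (co single) ≡⟨ cong (_+ card s (co single)) card-single ⟩
      1 + card s (co single)             ∎)
    2<degree : 2 < card s neighbour
    2<degree = begin
      3               ≤⟨ s≤s (m≤n⇒m≤o+n m 2≤k) ⟩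
      suc (m + k)     ≤⟨ edge-connectivity k single single-proper ⟩
      cut k n single  ≡⟨ ∑-only s u<s (λ v _ v≢u → ∑-zero s λ w _ →
                           cong (λ x → ⟦ x ∧ not (w ≡ᵇ u) ∧ dadj k n v w ⟧) (≢⇒≡ᵇ v≢u)) ⟩
      ∑ s (λ v → ⟦ (u ≡ᵇ u) ∧ neighbour v ⟧)
        ≡⟨ cong (λ x → ∑ s (λ v → ⟦ x ∧ neighbour v ⟧)) (≡ᵇ-refl u) ⟩
      card s neighbour ∎
    inside : ¬ (∃[ v ] (v < s × T (not (v ≡ᵇ u) ∧ dadj k n u v) × T (not (first2 v)))) →
      ∀ v → v < s → T (neighbour v) → T (first2 v)
    inside none v v<s nb with first2 v in eq
    ... | true  = _
    ... | false = none (v , v<s , nb , subst (T ∘ not) (sym eq) _)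

  -- Vertices 0 and 1 serve each other, and every other vertex has a neighbour outside the pair.
  -- Hence no component is a single vertex.
  same-side-neighbour : ∀ k → 2 ≤ k → ∀ u → u < t k n →
    ∃[ v ] (v < t k n × v ≢ u × T (dadj k n u v) × first2 u ≡ first2 v)
  same-side-neighbour k 2≤k 0 _ = 1 , 2≤t k , (λ ()) , subst T (sym (dadj-01 k)) _ , refl
  same-side-neighbour k 2≤k 1 _ = 0 , 1≤t k , (λ ()) ,
    subst T (sym (trans (dadj-sym k n 1 0) (dadj-01 k))) _ , refl
  same-side-neighbour k 2≤k u@(suc (suc _)) u<s
    with v , v<s , p , out ← neighbour-outside k 2≤k u u<s
    with v≢u , e ← Equivalence.to (T-∧ {not (v ≡ᵇ u)}) p
    = v , v<s , (λ { refl → subst (T ∘ not) (≡ᵇ-refl u) v≢u }) , e , sym (Equivalence.to T-not-≡ out)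

  first2-restricted : ∀ k → 2 ≤ k → IsRestrictedCut 2 (DCell k n) (boundary k n first2)
  -- The separated vertices are 0, in the pair, and 2, the least vertex outside it.
  first2-restricted k 2≤k = (fromℕ< (1≤t k) , fromℕ< 2<t , disconnected) , large
    where
    G = DCell k n
    F = boundary k n first2
    2<t : 2 < t k n
    2<t = ≤-trans (s≤s (s≤s (m≤n⇒m≤o+n m (≤-trans (s≤s z≤n) 2≤k)))) (n+k≤t k)
    disconnected : ¬ Reach G F (fromℕ< (1≤t k)) (fromℕ< 2<t)
    disconnected r with () ← subst₂ (λ x y → first2 x ≡ first2 y)
      (toℕ-fromℕ< (1≤t k)) (toℕ-fromℕ< 2<t) (reach-boundary k n first2 r)
    large : ComponentsAtLeast 2 G F
    large u with v , v<s , v≢u , e , eq ← same-side-neighbour k 2≤k (toℕ u) (toℕ<n u) =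
      f , inj , reaches
      where
      v′ : Fin (t k n)
      v′ = fromℕ< v<s
      v′≡v : toℕ v′ ≡ v
      v′≡v = toℕ-fromℕ< v<s
      v′≢u : v′ ≢ u
      v′≢u v′≡u = v≢u (trans (sym v′≡v) (cong toℕ v′≡u))
      f : Fin 2 → Fin (t k n)
      f Fin.zero    = u
      f (Fin.suc _) = v′
      inj : Injective _≡_ _≡_ f
      inj {Fin.zero}          {Fin.zero}          _  = refl
      inj {Fin.zero}          {Fin.suc Fin.zero}  eq = contradiction (sym eq) v′≢u
      inj {Fin.suc Fin.zero}  {Fin.zero}          eq = contradiction eq v′≢u
      inj {Fin.suc Fin.zero}  {Fin.suc Fin.zero}  _  = refl
      reaches : ∀ i → Reach G F u (f i)
      reaches Fin.zero    = here
      reaches (Fin.suc _) = boundary-edge k n first2 u v′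
        (subst (T ∘ dadj k n (toℕ u)) (sym v′≡v) e) (trans eq (cong first2 (sym v′≡v)))

theorem6 : (n k : ℕ) → n ≥ 2 → k ≥ 2 →
    RestrictedConn 2 (DCell k n) (2 * n + 2 * k ∸ 4)
theorem6 n@(suc (suc m)) k@(suc (suc l)) _ 2≤k@(s≤s (s≤s _)) =
  (boundary k n first2 , first2-restricted m k 2≤k ,
    trans (size-boundary k n first2) (trans (cut-first2 m k) (cut-value (lem₁ m l))))
  , λ F → cut-of-component k n F λ X 2≤X 2≤coX →
      subst (_≤ cut k n X) (cut-value (lem₂ m l)) (restricted-bound m l X 2≤X 2≤coX)
  where
  -- The truncated `∸ 4` is traded for an equation with `+ 4`, which the semiring solver can prove.
  cut-value : ∀ {x y} → y ≡ x + 4 → x ≡ y ∸ 4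
  cut-value {x} refl = sym (m+n∸n≡m x 4)
  lem₁ : ∀ m l → 2 * (2 + m) + 2 * (2 + l) ≡ 2 * (m + (2 + l)) + 4
  lem₁ = solve-∀
  lem₂ : ∀ m l → 2 * (2 + m) + 2 * (2 + l) ≡ 2 * (2 + m + l) + 4
  lem₂ = solve-∀
theorem6 (suc zero) _ (s≤s ()) _
theorem6 n (suc zero) _ (s≤s ())
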